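{- For every integer $d\ge 1$ and every tree $T$, there exists a polynomial $f$ such that for every integer $t\ge 1$ the following holds: if $G\in\mathcal{F}_T(t)$, $G$ is $T$-free, and $G$ does not contain $K_d(t)$ as a subgraph, then $\chi(G)\le f(t)$.
   Context: All graphs are finite and simple. $\chi(G)$ is the chromatic number of $G$. A graph is $T$-free if it has no induced subgraph isomorphic to $T$. For integers $k,t\ge1$, $K_k(t)$ denotes the complete $k$-partite graph in which each of the $k$ parts has exactly $t$ vertices; "contains $K_k(t)$ as a subgraph" means as a (not necessarily induced) subgraph. For a graph $G$ and integer $k\ge1$, $\tau_k(G)$ is the largest $t$ such that $G$ contains $K_k(t)$ as a subgraph. For a tree $T$, let $s$ be the maximum degree of $T$, and let $p$ be the minimum, over all vertices $r$ of $T$ of maximum degree, of the height of the rooted tree $(T,r)$ (the number of edges of a longest path in $T$ having $r$ as an endpoint). Define $\beta_T(t)=\big((\sum_{i=0}^{p}s^{i+1})\,t\big)^{(p+3)!\sum_{i=0}^{p}s^{i}}+1$. For a tree $T$ and integer $t\ge1$, $\mathcal{F}_T(t)=\mathcal{F}_1\cup\mathcal{F}_2$, where $\mathcal{F}_1$ is the class of graphs $G$ with $\tau_2(G)<t$, and $\mathcal{F}_2$ is the class of graphs $G$ with $\tau_2(G)\ge t$ such that for every subgraph of $G$ isomorphic to $K_2(\beta_T(t))$, at least one of its two parts (vertex sets of size $\beta_T(t)$) induces in $G$ a graph that contains $K_2(t)$ as a subgraph. -}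

module Defs where

open import Data.Fin.Base as Fin using (Fin; zero; suc; inject₁; fromℕ; combine; quotient; funToFin; finToFun)
open import Data.Fin.Properties as Fin using (any?; all?; finToFun-funToFin; injective⇒≤)
open import Data.Integer.Base as ℤ using (ℤ; 0ℤ)
open import Data.List.Base using (List; length; filter; allFin; map; upTo; foldr)
open import Data.List.Properties using (length-filter; length-tabulate)
open import Data.Nat.Base using (ℕ; zero; suc; _+_; _*_; _^_; _!; _≤_; _<_; z≤n; s≤s; NonZero)
open import Data.Nat.ListAction using (sum)
open import Data.Nat.Properties as ℕ using (≤-trans; ≤-reflexive; ≤∧≢⇒<; <⇒≤; m≤n*m)
open import Data.Product.Base using (Σ; ∃; _×_; _,_; proj₁; proj₂)
open import Data.Sum.Base using (_⊎_)
open import Function.Base using (_∘_; id)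
open import Function.Bundles using (_⇔_)
open import Function.Definitions using (Injective)
open import Level using (0ℓ)
open import Relation.Binary.Core using (Rel)
import Relation.Binary.Definitions as B
open import Relation.Binary.Construct.Closure.ReflexiveTransitive using (Star)
open import Relation.Binary.PropositionalEquality using (_≡_; _≢_; _≗_; refl; sym; trans; subst; subst₂)
open import Relation.Nullary.Decidable using (Dec; yes; no; map′; ¬?; _×-dec_; _→-dec_)
open import Relation.Nullary.Negation using (¬_; contradiction)
open import Relation.Unary using (Pred; Decidable)

IsLeast : Pred ℕ 0ℓ → Pred ℕ 0ℓ
IsLeast P m = P m × (∀ n → P n → m ≤ n)

IsGreatest : Pred ℕ 0ℓ → Pred ℕ 0ℓ
IsGreatest P m = P m × (∀ n → P n → n ≤ m)

least : ∀ {P : Pred ℕ 0ℓ} → Decidable P → ∀ m → P m → ∃ (IsLeast P)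
least P? zero p = zero , p , λ _ _ → z≤n
least {P} P? (suc m) p with P? zero
... | yes p₀ = zero , p₀ , λ _ _ → z≤n
... | no ¬p₀ with least {P ∘ suc} (P? ∘ suc) m p
...   | l , pl , min = suc l , pl , λ
  { zero    p₀ → contradiction p₀ ¬p₀
  ; (suc n) pn → s≤s (min n pn)
  }

greatest : ∀ {P : Pred ℕ 0ℓ} → Decidable P → ∃ P →
           ∀ b → (∀ n → P n → n ≤ b) → ∃ (IsGreatest P)
greatest P? (m , p) zero bound with bound m p
... | z≤n = zero , p , bound
greatest P? (m , p) (suc b) bound with P? (suc b)
... | yes pb = suc b , pb , bound
... | no ¬pb = greatest P? (m , p) b λ n pn →
  ℕ.≤-pred (≤∧≢⇒< (bound n pn) λ { refl → ¬pb pn })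

-- Without function extensionality, P must be assumed to respect ≗.
any-function? : ∀ {m n} {P : Pred (Fin m → Fin n) 0ℓ} →
                (∀ {f g} → f ≗ g → P f → P g) → Decidable P → Dec (∃ P)
any-function? resp P? = map′
  (λ (i , p) → finToFun i , p)
  (λ (f , p) → funToFin f , resp (λ x → sym (finToFun-funToFin f x)) p)
  (any? (P? ∘ finToFun))

injective? : ∀ {m n} → Decidable (Injective {A = Fin m} {B = Fin n} _≡_ _≡_)
injective? f = map′ (λ h {x} {y} → h x y) (λ h x y → h {x} {y})
  (all? λ x → all? λ y → (f x Fin.≟ f y) →-dec (x Fin.≟ y))

injective-resp : ∀ {m n} {f g : Fin m → Fin n} → f ≗ g →
                 Injective _≡_ _≡_ f → Injective _≡_ _≡_ g
injective-resp f≗g inj {x} {y} eq = inj (trans (f≗g x) (trans eq (sym (f≗g y))))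

record Graph : Set₁ where
  infix 4 _~_ _~?_
  field
    order  : ℕ
    _~_    : Rel (Fin order) 0ℓ
    _~?_   : B.Decidable _~_
    ~-sym  : B.Symmetric _~_
    ~-irr  : B.Irreflexive _≡_ _~_

  V : Set
  V = Fin order

open Graph using (V; order)

IsCopy : (H G : Graph) → Pred (V H → V G) 0ℓ
IsCopy H G φ = Injective _≡_ _≡_ φ × (∀ u v → Graph._~_ H u v → Graph._~_ G (φ u) (φ v))

IsInducedCopy : (H G : Graph) → Pred (V H → V G) 0ℓ
IsInducedCopy H G φ = Injective _≡_ _≡_ φ × (∀ u v → Graph._~_ H u v ⇔ Graph._~_ G (φ u) (φ v))

infix 4 _⊆_ _⊆ᵢ_

_⊆_ : Graph → Graph → Set
H ⊆ G = ∃ (IsCopy H G)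

_⊆ᵢ_ : Graph → Graph → Set
H ⊆ᵢ G = ∃ (IsInducedCopy H G)

_IsFreeOf_ : Graph → Graph → Set
G IsFreeOf T = ¬ (T ⊆ᵢ G)

_⊆?_ : B.Decidable _⊆_
H ⊆? G = any-function?
  (λ f≗g (inj , hom) → injective-resp f≗g inj ,
    λ u v uv → subst₂ (Graph._~_ G) (f≗g u) (f≗g v) (hom u v uv))
  (λ φ → injective? φ ×-dec
    (all? λ u → all? λ v → Graph._~?_ H u v →-dec Graph._~?_ G (φ u) (φ v)))

-- The subgraph of G induced on the vertex set {φ i}, listed without repetition by φ.
induced : (G : Graph) {m : ℕ} (φ : Fin m → V G) → Injective _≡_ _≡_ φ → Graph
induced G {m} φ _ = record
  { order = m
  ; _~_   = λ i j → φ i ~ φ j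
  ; _~?_  = λ i j → φ i ~? φ j
  ; ~-sym = ~-sym
  ; ~-irr = λ { refl → ~-irr refl }
  } where open Graph G

-- Vertex `combine i j` of K k t is the j-th vertex of the i-th part.
K : ℕ → ℕ → Graph
K k t = record
  { order = k * t
  ; _~_   = λ u v → quotient {k} t u ≢ quotient {k} t v
  ; _~?_  = λ u v → ¬? (quotient {k} t u Fin.≟ quotient {k} t v)
  ; ~-sym = λ u≁v eq → u≁v (sym eq)
  ; ~-irr = λ { refl u≢u → u≢u refl }
  }

-- K k 0 is the empty graph, so τ k G is 0 when G contains no K k t with t ≥ 1.
τ-greatest : ∀ k → .{{NonZero k}} → (G : Graph) → ∃ (IsGreatest (λ t → K k t ⊆ G))
τ-greatest k G = greatest (λ t → K k t ⊆? G) (0 , empty) (order G)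
  (λ t (_ , inj , _) → ≤-trans (m≤n*m t k) (injective⇒≤ inj))
  where
  noVertex : ¬ Fin (k * 0)
  noVertex u = Fin.¬Fin0 (subst Fin (ℕ.*-zeroʳ k) u)

  empty : K k 0 ⊆ G
  empty = (λ u → contradiction u noVertex)
        , (λ {u} → contradiction u noVertex)
        , (λ u → contradiction u noVertex)

τ : ∀ k → .{{NonZero k}} → Graph → ℕ
τ k G = proj₁ (τ-greatest k G)

IsColouring : (G : Graph) (c : ℕ) → Pred (V G → Fin c) 0ℓ
IsColouring G c f = ∀ u v → Graph._~_ G u v → f u ≢ f v

Colourable : Graph → ℕ → Set
Colourable G c = ∃ (IsColouring G c)

colourable? : ∀ G → Decidable (Colourable G)
colourable? G c = any-function?
  (λ f≗g col u v uv eq → col u v uv (trans (f≗g u) (trans eq (sym (f≗g v)))))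
  (λ f → all? λ u → all? λ v → Graph._~?_ G u v →-dec ¬? (f u Fin.≟ f v))

χ-least : ∀ G → ∃ (IsLeast (Colourable G))
χ-least G = least (colourable? G) (order G) (id , λ u v uv u≡v → Graph.~-irr G u≡v uv)

χ : Graph → ℕ
χ G = proj₁ (χ-least G)

module _ (G : Graph) where
  open Graph G using (_~_; _~?_)

  degree : V G → ℕ
  degree v = length (filter (v ~?_) (allFin (order G)))

  IsPath : (ℓ : ℕ) → Pred (Fin (suc ℓ) → V G) 0ℓ
  IsPath ℓ q = Injective _≡_ _≡_ q × (∀ (i : Fin ℓ) → q (inject₁ i) ~ q (suc i))

  PathFrom : V G → ℕ → Set
  PathFrom r ℓ = ∃ λ q → q zero ≡ r × IsPath ℓ q

  pathFrom? : ∀ r → Decidable (PathFrom r)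
  pathFrom? r ℓ = any-function?
    (λ f≗g (start , inj , adj) → trans (sym (f≗g zero)) start , injective-resp f≗g inj ,
      λ i → subst₂ _~_ (f≗g (inject₁ i)) (f≗g (suc i)) (adj i))
    (λ q → (q zero Fin.≟ r) ×-dec injective? q ×-dec
      (all? λ i → q (inject₁ i) ~? q (suc i)))

  height-greatest : ∀ r → ∃ (IsGreatest (PathFrom r))
  height-greatest r = greatest (pathFrom? r)
    (0 , (λ _ → r) , refl , (λ { {zero} {zero} _ → refl }) , λ ())
    (order G) (λ ℓ (_ , _ , inj , _) → <⇒≤ (injective⇒≤ inj))

  height : V G → ℕ
  height r = proj₁ (height-greatest r)

  Cycle : Set
  Cycle = ∃ λ k → Σ (Fin (3 + k) → V G) λ c →
    IsPath (2 + k) c × c (fromℕ (2 + k)) ~ c zero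

record Tree : Set₁ where
  field
    graph     : Graph
    vertex    : V graph
    connected : ∀ u v → Star (Graph._~_ graph) u v
    acyclic   : ¬ Cycle graph

module _ (T : Tree) where
  open Tree T using (graph; vertex)

  maxDegree-greatest : ∃ (IsGreatest (λ d → ∃ λ v → degree graph v ≡ d))
  maxDegree-greatest = greatest (λ d → any? λ v → degree graph v ℕ.≟ d)
    (degree graph vertex , vertex , refl) (order graph)
    (λ { _ (v , refl) → ≤-trans (length-filter _ (allFin (order graph)))
                                (≤-reflexive (length-tabulate id)) })

  maxDegree : ℕ
  maxDegree = proj₁ maxDegree-greatest

  minHeight-least : ∃ (IsLeast (λ h → ∃ λ r → degree graph r ≡ maxDegree × height graph r ≡ h))
  minHeight-least = least
    (λ h → any? λ r → (degree graph r ℕ.≟ maxDegree) ×-dec (height graph r ℕ.≟ h))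
    (height graph r) (r , r-max , refl)
    where
    r     = proj₁ (proj₁ (proj₂ maxDegree-greatest))
    r-max = proj₂ (proj₁ (proj₂ maxDegree-greatest))

  minHeight : ℕ
  minHeight = proj₁ minHeight-least

  -- Here 0 ^ 0 = 1, which matters only for the one-vertex tree (s = p = 0, so β t = 1).
  β : ℕ → ℕ
  β t = (sum (map (λ i → s ^ (i + 1)) (upTo (p + 1))) * t)
          ^ ((p + 3) ! * sum (map (λ i → s ^ i) (upTo (p + 1)))) + 1
    where
    s = maxDegree
    p = minHeight

𝓕₁ : ℕ → Graph → Set
𝓕₁ t G = τ 2 G < t

-- The graph induced by G on the i-th part, { φ (combine i j) ∣ j }, of a copy φ of K k b.
inducedOnPart : ∀ (G : Graph) k b (φ : V (K k b) → V G) → IsCopy (K k b) G φ → Fin k → Graph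
inducedOnPart G k b φ (inj , _) i = induced G (λ (j : Fin b) → φ (combine i j))
  (λ {j} {j′} eq → Fin.combine-injectiveʳ i j i j′ (inj eq))

𝓕₂ : Tree → ℕ → Graph → Set
𝓕₂ T t G = t ≤ τ 2 G ×
  (∀ φ (copy : IsCopy (K 2 (β T t)) G φ) →
    ∃ λ (i : Fin 2) → K 2 t ⊆ inducedOnPart G 2 (β T t) φ copy i)

𝓕 : Tree → ℕ → Graph → Set
𝓕 T t G = 𝓕₁ t G ⊎ 𝓕₂ T t G

-- Coefficients are listed with the constant term first.
Polynomial : Set
Polynomial = List ℤ

eval : Polynomial → ℤ → ℤ
eval f x = foldr (λ a y → a ℤ.+ x ℤ.* y) 0ℤ f

{-# OPTIONS --safe #-}

-- Suppose G has no K₂(t). Call a vertex good at height h if a highly branching rooted tree of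
-- height h starts there whose root-to-leaf paths are induced. Since G has no K₂(t), the closed
-- neighbourhoods of all but polynomially many vertices leave a large part of any such tree intact.
-- Double counting then shows that the vertices good at height h but not at height h + 1 induce a
-- graph of polynomial degeneracy, and a greedy embedding shows that a vertex good at a large
-- height yields an induced copy of T. Hence a T-free graph without K₂(t) has polynomially
-- bounded χ. For 𝓕₂, take two parts of a large K_k(N) in G. If neither induced a K₂(N′), both
-- would have few colours and so contain independent sets of size β(t), contradicting G ∈ 𝓕₂.
-- So some part splits, giving K_{k+1}(N′), and iterating from a huge K₂ reaches K_d(t).
module Submission where

open import Defs
open import Data.Fin.Base as Fin
  using (Fin; zero; suc; toℕ; fromℕ; fromℕ<; inject₁; inject≤; opposite; combine; quotient; remainder)
open import Data.Fin.Properties as Fin using (any?; all?)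
open import Data.Integer.Base as ℤ using (+_; 0ℤ)
import Data.Integer.Properties as ℤ
open import Data.List.Base using ([]; _∷_; map; upTo)
open import Data.Nat.Base
  using (ℕ; zero; suc; _+_; _*_; _^_; _!; _≤_; _<_; z≤n; s≤s; NonZero; >-nonZero)
open import Data.Nat.ListAction renaming (sum to listSum)
open import Data.Nat.Properties as ℕ
  using (≤-refl; ≤-trans; ≤-reflexive; <-≤-trans; <⇒≤; <⇒≱; ≮⇒≥; ≰⇒>; m≤m+n; m≤n+m;
         +-mono-≤; *-mono-≤; *-monoʳ-≤; *-monoˡ-≤)
open import Data.Nat.Solver using (module +-*-Solver)
open import Data.Product.Base using (Σ; ∃; _×_; _,_; proj₁; proj₂)
open import Data.Sum.Base as Sum using (_⊎_; inj₁; inj₂)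
open import Data.Unit.Base using (⊤; tt)
open import Data.Vec.Functional using (updateAt)
open import Data.Vec.Functional.Properties using (updateAt-updates; updateAt-minimal)
open import Function.Base using (_∘_; id; const)
open import Function.Bundles using (_⇔_; mk⇔; Equivalence)
open import Function.Definitions using (Injective)
open import Level using (0ℓ)
open import Relation.Binary.Construct.Closure.ReflexiveTransitive using (Star; ε; _◅_)
open import Relation.Binary.PropositionalEquality
  using (_≡_; _≢_; refl; sym; trans; cong; cong₂; subst; subst₂; module ≡-Reasoning)
open import Relation.Nullary.Decidable
  using (Dec; yes; no; ¬?; _×-dec_; _⊎-dec_; _→-dec_; decidable-stable)
open import Relation.Nullary.Negation using (¬_; contradiction)
open import Relation.Unary using (Pred; Decidable)
open import Relation.Unary.Properties using (U?)
open import Algebra.Properties.Semiring.Sum ℕ.+-*-semiring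
  using (sum; ∑-distrib-+; ∑-comm; *-distribˡ-sum; *-distribʳ-sum)

open Graph using (V; order)

private variable
  m n : ℕ
  A B : Set

-- Counting

sum-mono-≤ : {f g : Fin n → ℕ} → (∀ i → f i ≤ g i) → sum f ≤ sum g
sum-mono-≤ {zero}  f≤g = z≤n
sum-mono-≤ {suc n} f≤g = +-mono-≤ (f≤g zero) (sum-mono-≤ (f≤g ∘ suc))

sum-mono-< : {f g : Fin n → ℕ} → (∀ i → f i ≤ g i) → ∀ i → f i < g i → sum f < sum g
sum-mono-< f≤g zero    fi<gi = +-mono-≤ fi<gi (sum-mono-≤ (f≤g ∘ suc))
sum-mono-< f≤g (suc i) fi<gi = ℕ.+-mono-≤-< (f≤g zero) (sum-mono-< (f≤g ∘ suc) i fi<gi)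

sum-≤-* : ∀ k {f : Fin n → ℕ} → (∀ i → f i ≤ k) → sum f ≤ n * k
sum-≤-* {zero}  k f≤k = z≤n
sum-≤-* {suc n} k f≤k = +-mono-≤ (f≤k zero) (sum-≤-* k (f≤k ∘ suc))

term≤sum : (f : Fin n → ℕ) → ∀ i → f i ≤ sum f
term≤sum f zero    = m≤m+n _ _
term≤sum f (suc i) = ≤-trans (term≤sum (f ∘ suc) i) (m≤n+m _ _)

𝟙 : Dec A → ℕ
𝟙 (yes _) = 1
𝟙 (no _)  = 0

𝟙-mono : (a? : Dec A) (b? : Dec B) → (A → B) → 𝟙 a? ≤ 𝟙 b?
𝟙-mono (yes a) (yes b) f = ≤-refl
𝟙-mono (yes a) (no ¬b) f = contradiction (f a) ¬b
𝟙-mono (no ¬a) b?      f = z≤n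

𝟙-pos : (a? : Dec A) → A → 1 ≤ 𝟙 a?
𝟙-pos a? a = 𝟙-mono (yes a) a? id

count : {P : Pred (Fin n) 0ℓ} → Decidable P → ℕ
count P? = sum (λ i → 𝟙 (P? i))

module _ {P Q : Pred (Fin n) 0ℓ} (P? : Decidable P) (Q? : Decidable Q) where

  count-mono : (∀ i → P i → Q i) → count P? ≤ count Q?
  count-mono P⊆Q = sum-mono-≤ λ i → 𝟙-mono (P? i) (Q? i) (P⊆Q i)

  count-mono-< : (∀ i → P i → Q i) → ∀ i → ¬ P i → Q i → count P? < count Q?
  count-mono-< P⊆Q i ¬p q = sum-mono-< (λ i → 𝟙-mono (P? i) (Q? i) (P⊆Q i)) i pointwise
    where
    pointwise : 𝟙 (P? i) < 𝟙 (Q? i)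
    pointwise with P? i
    ... | yes p = contradiction p ¬p
    ... | no _  = 𝟙-pos (Q? i) q

  count-< : count Q? < count P? → ∃ λ i → P i × ¬ Q i
  count-< lt with any? (λ i → P? i ×-dec ¬? (Q? i))
  ... | yes found = found
  ... | no none   = contradiction
    (count-mono λ i p → decidable-stable (Q? i) λ ¬q → none (i , p , ¬q)) (<⇒≱ lt)

  count-⊎ : {R : Pred (Fin n) 0ℓ} (R? : Decidable R) → (∀ i → P i → Q i ⊎ R i) →
            count P? ≤ count Q? + count R?
  count-⊎ R? cover = ≤-trans (sum-mono-≤ pointwise) (≤-reflexive (∑-distrib-+ (λ i → 𝟙 (Q? i)) (λ i → 𝟙 (R? i))))
    where
    pointwise : ∀ i → 𝟙 (P? i) ≤ 𝟙 (Q? i) + 𝟙 (R? i)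
    pointwise i with P? i
    ... | no _  = z≤n
    ... | yes p with cover i p
    ...   | inj₁ q = ≤-trans (𝟙-pos (Q? i) q) (m≤m+n _ _)
    ...   | inj₂ r = ≤-trans (𝟙-pos (R? i) r) (m≤n+m _ _)

count-⋃ : {P : Pred (Fin n) 0ℓ} (P? : Decidable P) {Q : Fin m → Pred (Fin n) 0ℓ} (Q? : ∀ j → Decidable (Q j)) →
          (∀ i → P i → ∃ λ j → Q j i) → count P? ≤ sum (λ j → count (Q? j))
count-⋃ P? Q? cover = ≤-trans (sum-mono-≤ pointwise) (≤-reflexive (∑-comm (λ i j → 𝟙 (Q? j i))))
  where
  pointwise : ∀ i → 𝟙 (P? i) ≤ sum (λ j → 𝟙 (Q? j i))
  pointwise i with P? i
  ... | no _  = z≤n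
  ... | yes p with cover i p
  ...   | j , q = ≤-trans (𝟙-pos (Q? j i) q) (term≤sum (λ j → 𝟙 (Q? j i)) j)

count-pos : {P : Pred (Fin n) 0ℓ} (P? : Decidable P) → ∀ i → P i → 1 ≤ count P?
count-pos P? i p = ≤-trans (𝟙-pos (P? i) p) (term≤sum (λ i → 𝟙 (P? i)) i)

count-none : {P : Pred (Fin n) 0ℓ} (P? : Decidable P) → (∀ i → ¬ P i) → count P? ≡ 0
count-none {n = n} P? none = ℕ.n≤0⇒n≡0 (≤-trans (sum-≤-* 0 pointwise) (≤-reflexive (ℕ.*-zeroʳ n)))
  where
  pointwise : ∀ i → 𝟙 (P? i) ≤ 0
  pointwise i = 𝟙-mono (P? i) (no λ ()) (none i)

count≤1 : {P : Pred (Fin n) 0ℓ} (P? : Decidable P) → (∀ i j → P i → P j → i ≡ j) → count P? ≤ 1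
count≤1 {n = zero}  P? unique = z≤n
count≤1 {n = suc n} P? unique with P? zero
... | yes p = ≤-reflexive (cong suc (count-none (P? ∘ suc) λ i q → contradiction (unique _ _ p q) λ ()))
... | no _  = count≤1 (P? ∘ suc) λ i j p q → Fin.suc-injective (unique _ _ p q)

count-all : {P : Pred (Fin n) 0ℓ} (P? : Decidable P) → (∀ i → P i) → n ≤ count P?
count-all {n = zero}  P? all = z≤n
count-all {n = suc n} P? all = +-mono-≤ (𝟙-pos (P? zero) (all zero)) (count-all (P? ∘ suc) (all ∘ suc))

pick : {P : Pred (Fin n) 0ℓ} → ∀ t (P? : Decidable P) → t ≤ count P? →
       ∃ λ (f : Fin t → Fin n) → Injective _≡_ _≡_ f × (∀ i → P (f i))
pick zero P? _ = (λ ()) , (λ {}) , λ ()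
pick {n = suc n} (suc t) P? t≤ with P? zero
... | no _ with pick (suc t) (P? ∘ suc) t≤
...   | f , inj , Pf = suc ∘ f , inj ∘ Fin.suc-injective , Pf
pick {n = suc n} (suc t) P? (s≤s t≤) | yes p with pick t (P? ∘ suc) t≤
...   | f , inj , Pf = f′ , inj′ , Pf′
  where
  f′ : Fin (suc t) → Fin (suc n)
  f′ zero    = zero
  f′ (suc i) = suc (f i)

  inj′ : Injective _≡_ _≡_ f′
  inj′ {zero}  {zero}  eq = refl
  inj′ {suc i} {suc j} eq = cong suc (inj (Fin.suc-injective eq))

  Pf′ : ∀ i → _
  Pf′ zero    = p
  Pf′ (suc i) = Pf i

-- The pairs (r , c) with r ∈ R, c ∈ C and B r c are counted by rows and by columns;
-- the factor s allows the rows to be bounded below by a fraction of w.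
double-count : ∀ {R : Pred (Fin m) 0ℓ} {C : Pred (Fin n) 0ℓ} {B : Fin m → Pred (Fin n) 0ℓ}
               (R? : Decidable R) (C? : Decidable C) (B? : ∀ r → Decidable (B r)) (w s k : ℕ) →
               (∀ r → R r → w ≤ s * count (λ c → C? c ×-dec B? r c)) →
               (∀ c → C c → count (λ r → B? r c) ≤ k) →
               count R? * w ≤ s * (count C? * k)
double-count R? C? B? w s k row column = begin
  count R? * w                                             ≡⟨ *-distribʳ-sum w (λ r → 𝟙 (R? r)) ⟩
  sum (λ r → 𝟙 (R? r) * w)                                 ≤⟨ sum-mono-≤ rows ⟩
  sum (λ r → s * sum (λ c → 𝟙 (C? c ×-dec B? r c)))
    ≡⟨ *-distribˡ-sum s (λ r → sum (λ c → 𝟙 (C? c ×-dec B? r c))) ⟨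
  s * sum (λ r → sum (λ c → 𝟙 (C? c ×-dec B? r c)))
    ≡⟨ cong (s *_) (∑-comm (λ r c → 𝟙 (C? c ×-dec B? r c))) ⟩
  s * sum (λ c → sum (λ r → 𝟙 (C? c ×-dec B? r c)))        ≤⟨ *-monoʳ-≤ s (sum-mono-≤ columns) ⟩
  s * sum (λ c → 𝟙 (C? c) * k)                             ≡⟨ cong (s *_) (*-distribʳ-sum k (λ c → 𝟙 (C? c))) ⟨
  s * (count C? * k)                                       ∎
  where
  open ℕ.≤-Reasoning

  rows : ∀ r → 𝟙 (R? r) * w ≤ s * sum (λ c → 𝟙 (C? c ×-dec B? r c))
  rows r with R? r
  ... | no _  = z≤n
  ... | yes p = ≤-trans (≤-reflexive (ℕ.+-identityʳ w)) (row r p)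

  columns : ∀ c → sum (λ r → 𝟙 (C? c ×-dec B? r c)) ≤ 𝟙 (C? c) * k
  columns c with C? c
  ... | no ¬q = ≤-reflexive (count-none (λ r → no ¬q ×-dec B? r c) λ _ → ¬q ∘ proj₁)
  ... | yes q = ≤-trans (count-mono (λ r → yes q ×-dec B? r c) (λ r → B? r c) λ _ → proj₂)
    (≤-trans (column c q) (≤-reflexive (sym (ℕ.+-identityʳ k))))

-- Complete multipartite subgraphs

module _ (G : Graph) where
  open Graph G using (_~_; ~-irr)

  -- Injectivity is asked only within each part: vertices of different parts are adjacent, hence
  -- distinct by irreflexivity.
  IsMultipartite : ∀ {k N} → (Fin k → Fin N → V G) → Set
  IsMultipartite P = (∀ i → Injective _≡_ _≡_ (P i)) × (∀ i i′ j j′ → i ≢ i′ → P i j ~ P i′ j′)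

  module _ {k N : ℕ} where

    copyOf : (Fin k → Fin N → V G) → V (K k N) → V G
    copyOf P u = P (quotient {k} N u) (remainder {k} N u)

    copyOf-combine : ∀ P i j → copyOf P (combine i j) ≡ P i j
    copyOf-combine P i j = cong (λ (i , j) → P i j) (Fin.remQuot-combine {k} i j)

    copyOf-isCopy : ∀ {P} → IsMultipartite P → IsCopy (K k N) G (copyOf P)
    copyOf-isCopy {P} (inj , adj) = inj′ , λ u v → adj _ _ _ _
      where
      inj′ : Injective _≡_ _≡_ (copyOf P)
      inj′ {u} {v} eq with quotient {k} N u Fin.≟ quotient {k} N v
      ... | no q≢  = contradiction (adj _ _ _ _ q≢) (~-irr eq)
      ... | yes q≡ = trans (sym (Fin.combine-remQuot {k} N u))
        (trans (cong₂ combine q≡ (inj _ (trans eq (cong (λ i → P i (remainder {k} N v)) (sym q≡)))))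
               (Fin.combine-remQuot {k} N v))

    parts : K k N ⊆ G → ∃ λ (P : Fin k → Fin N → V G) → IsMultipartite P
    parts (φ , inj , adj) = (λ i j → φ (combine i j))
      , (λ i → Fin.combine-injectiveʳ i _ i _ ∘ inj)
      , λ i i′ j j′ i≢i′ → adj _ _ λ eq → i≢i′
          (trans (sym (quotient-combine i j)) (trans eq (quotient-combine i′ j′)))
      where
      quotient-combine : ∀ i j → quotient {k} N (combine i j) ≡ i
      quotient-combine i j = cong proj₁ (Fin.remQuot-combine {k} i j)

  K-mono : ∀ {k k′ N N′} (f : Fin k′ → Fin k) → Injective _≡_ _≡_ f → N′ ≤ N → K k N ⊆ G → K k′ N′ ⊆ G
  K-mono f f-inj N′≤N copy with parts copy
  ... | P , inj , adj = copyOf (λ i j → P (f i) (inject≤ j N′≤N)) , copyOf-isCopy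
    ( (λ i → Fin.inject≤-injective N′≤N N′≤N _ _ ∘ inj (f i))
    , λ i i′ j j′ i≢i′ → adj _ _ _ _ (i≢i′ ∘ f-inj))

-- Rooted trees without short cuts

module _ (G : Graph) where
  open Graph G using (_~_; _~?_)

  Far : V G → V G → Set
  Far r c = ¬ r ~ c × r ≢ c

  far? : ∀ r → Decidable (Far r)
  far? r c = ¬? (r ~? c) ×-dec ¬? (r Fin.≟ c)

  avoid : {A : Pred (V G) 0ℓ} → Decidable A → ∀ r → Decidable (λ c → A c × Far r c)
  avoid A? r c = A? c ×-dec far? r c

  -- Some m-branching rooted tree of walks of height h starts at v, has its other vertices in A,
  -- and each of its root-to-leaf paths is induced in G.
  -- Different branches may meet or be adjacent.
  Good : ℕ → ℕ → {A : Pred (V G) 0ℓ} → Decidable A → V G → Set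
  good? : ∀ m h {A} (A? : Decidable A) → Decidable (Good m h {A} A?)
  child? : ∀ m h {A} (A? : Decidable A) v → Decidable (λ c → A c × v ~ c × Good m h (avoid A? v) c)

  Good m zero    A? v = ⊤
  Good m (suc h) A? v = m ≤ count (child? m h A? v)

  good? m zero    A? v = yes tt
  good? m (suc h) A? v = m ℕ.≤? count (child? m h A? v)

  child? m h A? v c = A? c ×-dec v ~? c ×-dec good? m h (avoid A? v) c

  Good-mono : ∀ {m m′} h {A A′} (A? : Decidable A) (A′? : Decidable A′) {v} →
              m′ ≤ m → (∀ c → A c → A′ c) → Good m h A? v → Good m′ h A′? v
  Good-mono zero    A? A′? m′≤m A⊆A′ _ = tt
  Good-mono {m} {m′} (suc h) A? A′? {v} m′≤m A⊆A′ g = ≤-trans m′≤m (≤-trans g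
    (count-mono (child? m h A? v) (child? m′ h A′? v) λ c (a , vc , gc) →
      A⊆A′ c a , vc , Good-mono h (avoid A? v) (avoid A′? v) m′≤m (λ x (a , f) → A⊆A′ x a , f) gc))

  Good-pred : ∀ {m} h {A} (A? : Decidable A) {v} → Good m (suc h) A? v → Good m h A? v
  Good-pred zero A? g = tt
  Good-pred {m} (suc h) A? {v} g = ≤-trans g
    (count-mono (child? m (suc h) A? v) (child? m h A? v) λ c (a , vc , gc) →
      a , vc , Good-pred h (avoid A? v) gc)

-- Good trees survive the removal of most closed neighbourhoods

κ : ℕ → ℕ → ℕ
κ t zero    = 0
κ t (suc h) = t + 4 * t * (suc (κ t h))

module _ (G : Graph) (t : ℕ) (1≤t : 1 ≤ t) (no-K₂ : ¬ (K 2 t ⊆ G)) where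
  open Graph G using (_~_; _~?_; ~-sym)

  private instance
    t-nonZero : NonZero t
    t-nonZero = >-nonZero 1≤t

  biclique : (f : Fin t → V G) → Injective _≡_ _≡_ f → {C : Pred (V G) 0ℓ} (C? : Decidable C) →
             (∀ i c → C c → f i ~ c) → count C? < t
  biclique f f-inj C? adj = ≰⇒> λ t≤C → no-K₂ (copy (pick t C? t≤C))
    where
    copy : _ → K 2 t ⊆ G
    copy (g , g-inj , Cg) = copyOf G P , copyOf-isCopy G (inj , P-adj)
      where
      P : Fin 2 → Fin t → V G
      P zero       = f
      P (suc zero) = g

      inj : ∀ i → Injective _≡_ _≡_ (P i)
      inj zero       = f-inj
      inj (suc zero) = g-inj

      P-adj : ∀ i i′ j j′ → i ≢ i′ → P i j ~ P i′ j′
      P-adj zero       zero       j j′ i≢i′ = contradiction refl i≢i′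
      P-adj zero       (suc zero) j j′ _    = adj _ _ (Cg j′)
      P-adj (suc zero) zero       j j′ _    = ~-sym (adj _ _ (Cg j))
      P-adj (suc zero) (suc zero) j j′ i≢i′ = contradiction refl i≢i′

  module _ {C : Pred (V G) 0ℓ} (C? : Decidable C) where

    missed? : ∀ r → Decidable (λ c → C c × ¬ r ~ c)
    missed? r c = C? c ×-dec ¬? (r ~? c)

    nearlyComplete? : Decidable (λ r → 2 * t * count (missed? r) ≤ count C?)
    nearlyComplete? r = 2 * t * count (missed? r) ℕ.≤? count C?

    -- t vertices each missing at most |C| / 2t of C have at least |C| / 2 common neighbours in C.
    nearlyComplete-< : 2 * t ≤ count C? → count nearlyComplete? < t
    nearlyComplete-< 2t≤C = ≰⇒> λ t≤ → absurd (pick t nearlyComplete? t≤)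
      where
      absurd : ¬ (∃ λ (f : Fin t → V G) → Injective _≡_ _≡_ f ×
                  (∀ i → 2 * t * count (missed? (f i)) ≤ count C?))
      absurd (f , f-inj , few) = <⇒≱ C′<t (ℕ.*-cancelˡ-≤ 2 (≤-trans 2t≤C C≤2C′))
        where
        common? : Decidable (λ c → C c × (∀ i → f i ~ c))
        common? c = C? c ×-dec all? (λ i → f i ~? c)

        C′<t : count common? < t
        C′<t = biclique f f-inj common? λ i c (_ , adj) → adj i

        cover : ∀ c → C c → (C c × (∀ i → f i ~ c)) ⊎ ∃ λ i → C c × ¬ f i ~ c
        cover c p with all? (λ i → f i ~? c)
        ... | yes adj = inj₁ (p , adj)
        ... | no ¬adj with Fin.¬∀⟶∃¬ t _ (λ i → f i ~? c) ¬adj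
        ...   | i , ¬a = inj₂ (i , p , ¬a)

        missedBySome? : Decidable (λ c → ∃ λ i → C c × ¬ f i ~ c)
        missedBySome? c = any? λ i → missed? (f i) c

        C≤2C′ : count C? ≤ 2 * count common?
        C≤2C′ = ℕ.*-cancelˡ-≤ t (ℕ.+-cancelʳ-≤ (t * count C?) _ _ (begin
          t * count C? + t * count C?
            ≡⟨ solve 2 (λ t c → t :* c :+ t :* c := con 2 :* t :* c) refl t (count C?) ⟩
          2 * t * count C?
            ≤⟨ *-monoʳ-≤ (2 * t) (≤-trans (count-⊎ C? common? missedBySome? cover)
                 (ℕ.+-monoʳ-≤ _ (count-⋃ missedBySome? (λ i → missed? (f i)) λ _ → id))) ⟩
          2 * t * (count common? + sum (λ i → count (missed? (f i))))
            ≡⟨ ℕ.*-distribˡ-+ (2 * t) (count common?) _ ⟩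
          2 * t * count common? + 2 * t * sum (λ i → count (missed? (f i)))
            ≡⟨ cong (_+_ (2 * t * count common?)) (*-distribˡ-sum (2 * t) (λ i → count (missed? (f i)))) ⟩
          2 * t * count common? + sum (λ i → 2 * t * count (missed? (f i)))
            ≤⟨ +-mono-≤ (≤-reflexive (solve 2 (λ t c → con 2 :* t :* c := t :* (con 2 :* c)) refl t (count common?)))
                 (sum-≤-* (count C?) few) ⟩
          t * (2 * count common?) + t * count C? ∎))
          where
          open ℕ.≤-Reasoning
          open +-*-Solver

  -- Induction on the height, which explains the recursion of `κ`. Among the destructive `r`, fewer
  -- than `t` are adjacent to nearly all children of `v`. Each of the others must damage a `1/(4t)`
  -- fraction of the children from below, while by induction each child is damaged by at most
  -- `suc (κ t h)` vertices.
  few-destroy : ∀ {m m′} → 4 * t * suc m′ ≤ m → ∀ h {A} (A? : Decidable A) v → Good G m h A? v →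
                count (λ r → ¬? (good? G m′ h (avoid G A? r) v)) ≤ κ t h
  few-destroy {m′ = m′} m≥ zero A? v g = ≤-reflexive
    (count-none (λ r → ¬? (good? G m′ 0 (avoid G A? r) v)) λ _ ¬tt → ¬tt tt)
  few-destroy {m} {m′} m≥ (suc h) A? v g = begin
    count bad?                            ≤⟨ count-⊎ bad? (nearlyComplete? C?) sparse? split ⟩
    count (nearlyComplete? C?) + count sparse?
      ≤⟨ +-mono-≤ (<⇒≤ (nearlyComplete-< C? 2t≤C)) sparse-≤ ⟩
    t + 4 * t * suc (κ t h)               ∎
    where
    open ℕ.≤-Reasoning
    C? = child? G m h A? v
    bad? = λ r → ¬? (good? G m′ (suc h) (avoid G A? r) v)
    sparse? = λ r → bad? r ×-dec ¬? (nearlyComplete? C? r)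
    -- `r` damages the child `c` if it is `c` itself or destroys the tree above `c`.
    B? = λ r c → r Fin.≟ c ⊎-dec ¬? (good? G m′ h (avoid G (avoid G A? v) r) c)

    split : ∀ r → _ → _ ⊎ _
    split r b with nearlyComplete? C? r
    ... | yes d = inj₁ d
    ... | no ¬d = inj₂ (b , ¬d)

    4t≤C : 4 * t * suc m′ ≤ count C?
    4t≤C = ≤-trans m≥ g

    -- The `suc` in the branching threshold keeps `4 * t ≤ count C?` even when `m′` is 0; this also
    -- makes `count C?` positive, so that it can be cancelled in `sparse-≤`.
    2t≤C : 2 * t ≤ count C?
    2t≤C = ≤-trans (*-monoˡ-≤ t (s≤s (s≤s (z≤n {2})))) (≤-trans (ℕ.m≤m*n (4 * t) (suc m′)) 4t≤C)

    -- More than a `1/(2t)` fraction of the children are not adjacent to `r`; fewer than `m′` of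
    -- these remain usable, and `m′` is at most a `1/(4t)` fraction.
    row : ∀ r → _ × _ → count C? ≤ 4 * t * count (λ c → C? c ×-dec B? r c)
    row r (bad , ¬dense) = ℕ.+-cancelʳ-≤ (count C?) _ _ (begin
      count C? + count C?        ≤⟨ +-mono-≤ C≤ C≤ ⟩
      2 * t * (x + m′) + 2 * t * (x + m′)
        ≡⟨ solve 3 (λ t x m → con 2 :* t :* (x :+ m) :+ con 2 :* t :* (x :+ m)
                    := con 4 :* t :* x :+ con 4 :* t :* m) refl t x m′ ⟩
      4 * t * x + 4 * t * m′     ≤⟨ ℕ.+-monoʳ-≤ (4 * t * x) (≤-trans (*-monoʳ-≤ (4 * t) (ℕ.n≤1+n m′)) 4t≤C) ⟩
      4 * t * x + count C?       ∎)
      where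
      open +-*-Solver
      x = count (λ c → C? c ×-dec B? r c)
      kept? = child? G m′ h (avoid G A? r) v

      cover : ∀ c → _ → _ ⊎ _
      cover c ((a , vc , gc) , ¬rc) with r Fin.≟ c
      ... | yes eq = inj₁ ((a , vc , gc) , inj₁ eq)
      ... | no neq with good? G m′ h (avoid G (avoid G A? v) r) c
      ...   | no ¬gd = inj₁ ((a , vc , gc) , inj₂ ¬gd)
      ...   | yes gd = inj₂ ((a , ¬rc , neq) , vc ,
        -- The two allowed sets differ only in the order in which `v` and `r` are avoided.
        Good-mono G h (avoid G (avoid G A? v) r) (avoid G (avoid G A? r) v) ≤-refl
          (λ y ((a , f) , f′) → (a , f′) , f) gd)

      C≤ : count C? ≤ 2 * t * (x + m′)
      C≤ = begin
        count C?                             ≤⟨ <⇒≤ (≰⇒> ¬dense) ⟩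
        2 * t * count (missed? C? r)
          ≤⟨ *-monoʳ-≤ (2 * t) (≤-trans (count-⊎ (missed? C? r) (λ c → C? c ×-dec B? r c) kept? cover)
               (ℕ.+-monoʳ-≤ x (<⇒≤ (≰⇒> bad)))) ⟩
        2 * t * (x + m′)                     ∎

    column : ∀ c → _ → count (λ r → B? r c) ≤ suc (κ t h)
    column c (a , vc , gc) = ≤-trans
      (count-⊎ (λ r → B? r c) (λ r → r Fin.≟ c) (λ r → ¬? (good? G m′ h (avoid G (avoid G A? v) r) c)) (λ _ → id))
      (+-mono-≤ (count≤1 (λ r → r Fin.≟ c) λ i j p q → trans p (sym q))
                (few-destroy m≥ h (avoid G A? v) c gc))

    sparse-≤ : count sparse? ≤ 4 * t * suc (κ t h)
    sparse-≤ = ℕ.*-cancelʳ-≤ _ _ (count C?) {{>-nonZero (≤-trans (≤-trans 1≤t (m≤m+n t _)) 2t≤C)}} (begin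
      count sparse? * count C?
        ≤⟨ double-count sparse? C? B? (count C?) (4 * t) (suc (κ t h)) row column ⟩
      4 * t * (count C? * suc (κ t h))
        ≡⟨ solve 3 (λ s c k → s :* (c :* k) := s :* k :* c) refl (4 * t) (count C?) (suc (κ t h)) ⟩
      4 * t * suc (κ t h) * count C?  ∎)
      where open +-*-Solver

-- Colouring

module _ (G : Graph) where
  open Graph G using (_~_; _~?_; ~-sym; ~-irr)

  -- Colours are numbers below `k` rather than elements of `Fin k`: palettes can then be shifted and
  -- joined, and an empty `S` is colourable with `k = 0`, although `f` is defined on all vertices.
  ColourableOn : Pred (V G) 0ℓ → ℕ → Set
  ColourableOn S k = ∃ λ (f : V G → ℕ) → (∀ v → S v → f v < k) × (∀ u v → S u → S v → u ~ v → f u ≢ f v)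

  colourableOn-⊆ : ∀ {S S′ k} → (∀ v → S v → S′ v) → ColourableOn S′ k → ColourableOn S k
  colourableOn-⊆ S⊆S′ (f , f< , proper) =
    f , (λ v → f< v ∘ S⊆S′ v) , λ u v p q → proper u v (S⊆S′ u p) (S⊆S′ v q)

  colourableOn-∪ : ∀ {S S′ k l} → Decidable S → ColourableOn S k → ColourableOn S′ l →
                   ColourableOn (λ v → S v ⊎ S′ v) (k + l)
  colourableOn-∪ {S} {S′} {k} {l} S? (f , f< , f-proper) (g , g< , g-proper) = h , h< , h-proper
    where
    h : V G → ℕ
    h v with S? v
    ... | yes _ = f v
    ... | no _  = k + g v

    h< : ∀ v → S v ⊎ S′ v → h v < k + l
    h< v p with S? v | p
    ... | yes s | _       = ≤-trans (f< v s) (m≤m+n k l)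
    ... | no ¬s | inj₁ s  = contradiction s ¬s
    ... | no ¬s | inj₂ s′ = ℕ.+-monoʳ-< k (g< v s′)

    h-proper : ∀ u v → S u ⊎ S′ u → S v ⊎ S′ v → u ~ v → h u ≢ h v
    h-proper u v p q uv with S? u | S? v | p | q
    ... | yes s | yes s′ | _ | _ = f-proper u v s s′ uv
    ... | yes s | no _   | _ | _ = ℕ.<⇒≢ (<-≤-trans (f< u s) (m≤m+n k _))
    ... | no _  | yes s  | _ | _ = ℕ.<⇒≢ (<-≤-trans (f< v s) (m≤m+n k _)) ∘ sym
    ... | no ¬s | no _   | inj₁ s | _ = contradiction s ¬s
    ... | no _  | no ¬s  | _ | inj₁ s = contradiction s ¬s
    ... | no _  | no _   | inj₂ s | inj₂ s′ = g-proper u v s s′ uv ∘ ℕ.+-cancelˡ-≡ k _ _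

  nbr? : {S : Pred (V G) 0ℓ} → Decidable S → ∀ v → Decidable (λ u → S u × v ~ u)
  nbr? S? v u = S? u ×-dec v ~? u

  -- If all `D` colours occurred on `N`, counting pairs of a colour and a vertex of `N` bearing it
  -- would give `D ≤ count N?`, since each vertex bears only one colour.
  freeColour : ∀ {D} {N : Pred (V G) 0ℓ} (N? : Decidable N) (f : V G → ℕ) → count N? < D →
               ∃ λ x → x < D × (∀ u → N u → f u ≢ x)
  freeColour {D} N? f N<D
    with any? {n = D} (λ x → all? λ u → N? u →-dec ¬? (f u ℕ.≟ toℕ x))
  ... | yes (x , free) = toℕ x , Fin.toℕ<n x , free
  ... | no none = contradiction (begin
    D                       ≤⟨ count-all (U? {A = Fin D}) (λ _ → tt) ⟩
    count (U? {A = Fin D})  ≡⟨ ℕ.*-identityʳ _ ⟨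
    count (U? {A = Fin D}) * 1
      ≤⟨ double-count (U? {A = Fin D}) N? (λ x u → f u ℕ.≟ toℕ x) 1 1 1
           (λ x _ → used x)
           (λ u _ → count≤1 (λ (x : Fin D) → f u ℕ.≟ toℕ x) λ x y p q → Fin.toℕ-injective (trans (sym p) q)) ⟩
    1 * (count N? * 1)      ≡⟨ trans (ℕ.*-identityˡ _) (ℕ.*-identityʳ _) ⟩
    count N?                ∎) (<⇒≱ N<D)
    where
    open ℕ.≤-Reasoning
    used : ∀ x → 1 ≤ 1 * count (λ u → N? u ×-dec f u ℕ.≟ toℕ x)
    used x with any? (λ u → N? u ×-dec f u ℕ.≟ toℕ x)
    ... | yes (u , p) = ≤-trans (count-pos (λ u → N? u ×-dec f u ℕ.≟ toℕ x) u p)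
                                (≤-reflexive (sym (ℕ.*-identityˡ _)))
    ... | no ¬used = contradiction (x , λ u n eq → ¬used (u , n , eq)) none

  Degenerate : ℕ → Pred (V G) 0ℓ → Set₁
  Degenerate D S = {S′ : Pred (V G) 0ℓ} (S′? : Decidable S′) → (∀ v → S′ v → S v) → ∃ S′ →
                   ∃ λ v → S′ v × count (nbr? S′? v) < D

  -- Greedy colouring: remove a vertex with fewer than `D` neighbours in the set, colour the rest by
  -- induction on its size, and give the removed vertex a colour free among its neighbours.
  degenerate⇒colourable : ∀ {D S} (S? : Decidable S) → Degenerate D S → ColourableOn S D
  degenerate⇒colourable {D} S? degen = go _ S? degen ≤-refl
    where
    go : ∀ n {S} (S? : Decidable S) → Degenerate D S → count S? ≤ n → ColourableOn S D
    go n S? degen S≤n with any? S?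
    ... | no empty = (λ _ → 0) , (λ v p → contradiction (v , p) empty)
                   , λ u v p → contradiction (u , p) empty
    go zero S? degen S≤n | yes (v , p) = contradiction S≤n (<⇒≱ (count-pos S? v p))
    go (suc n) {S} S? degen S≤n | yes nonempty with degen S? (λ _ → id) nonempty
    ... | v , Sv , deg<D = extend
          (go n S′? (λ {_} T? T⊆S′ → degen T? λ u → proj₁ ∘ T⊆S′ u)
            (ℕ.≤-pred (<-≤-trans (count-mono-< S′? S? (λ _ → proj₁) v (λ (_ , v≢v) → v≢v refl) Sv) S≤n)))
      where
      S′ : Pred (V G) 0ℓ
      S′ u = S u × u ≢ v

      S′? : Decidable S′
      S′? u = S? u ×-dec ¬? (u Fin.≟ v)

      extend : ColourableOn S′ D → ColourableOn S D
      extend (f , f< , proper) with freeColour (nbr? S? v) f deg<D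
      ... | x , x<D , free = f′ , f′< , f′-proper
        where
        f′ : V G → ℕ
        f′ u with u Fin.≟ v
        ... | yes _ = x
        ... | no _  = f u

        f′< : ∀ u → S u → f′ u < D
        f′< u p with u Fin.≟ v
        ... | yes _  = x<D
        ... | no u≢v = f< u (p , u≢v)

        f′-proper : ∀ u w → S u → S w → u ~ w → f′ u ≢ f′ w
        f′-proper u w p q uw with u Fin.≟ v | w Fin.≟ v
        ... | yes refl | yes refl = contradiction uw (~-irr refl)
        ... | yes refl | no _     = free w (q , uw) ∘ sym
        ... | no _     | yes refl = free u (p , ~-sym uw)
        ... | no u≢v   | no w≢v   = proper u w (p , u≢v) (q , w≢v) uw

-- Climbing to greater height

-- Branching thresholds for the climb: one application of `few-destroy` lowers the threshold from
-- `level t m (suc j)` to `level t m j`. The index `j` counts the heights still to be climbed, so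
-- the top height has threshold `m`.
level : ℕ → ℕ → ℕ → ℕ
level t m zero    = m
level t m (suc j) = 4 * t * suc (level t m j)

colours : ℕ → ℕ → ℕ → ℕ → ℕ
colours t m zero    j = 0
colours t m (suc h) j = colours t m h (suc j) + (κ t h + level t m j)

module _ (G : Graph) (t : ℕ) (1≤t : 1 ≤ t) (no-K₂ : ¬ (K 2 t ⊆ G)) where
  open Graph G using (_~_)

  -- Each vertex v has its tree spoilt by at most κ t h vertices r, so in a set where all degrees
  -- are at least κ t h + m′ some r has m′ unspoilt neighbours and is itself good at height h + 1.
  stuck-degenerate : ∀ {m m′} → 4 * t * suc m′ ≤ m → ∀ h →
                     Degenerate G (κ t h + m′) (λ v → Good G m h U? v × ¬ Good G m′ (suc h) U? v)
  stuck-degenerate {m} {m′} m≥ h {S} S? S⊆ (v₀ , Sv₀)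
    with any? (λ v → S? v ×-dec count (nbr? G S? v) ℕ.<? κ t h + m′)
  ... | yes found = found
  -- With all degrees large, double counting the spoilt pairs in `S` gives `count S? * suc (κ t h) ≤
  -- count S? * κ t h`.
  ... | no none = contradiction
    (ℕ.*-cancelˡ-≤ (count S?) {{>-nonZero (count-pos S? v₀ Sv₀)}}
      (≤-trans (double-count S? S? B? (suc (κ t h)) 1 (κ t h) row column) (≤-reflexive (ℕ.*-identityˡ _))))
    (<⇒≱ ≤-refl)
    where
    B? = λ r v → ¬? (good? G m′ h (avoid G U? r) v)

    column : ∀ v → S v → count (λ r → B? r v) ≤ κ t h
    column v Sv = few-destroy G t 1≤t no-K₂ m≥ h U? v (proj₁ (S⊆ v Sv))

    row : ∀ r → S r → suc (κ t h) ≤ 1 * count (λ v → S? v ×-dec B? r v)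
    row r Sr = ≤-trans (≰⇒> few⇒good) (≤-reflexive (sym (ℕ.*-identityˡ _)))
      where
      cover : ∀ v → S v × r ~ v → (S v × ¬ Good G m′ h (avoid G U? r) v) ⊎
                                  (⊤ × r ~ v × Good G m′ h (avoid G U? r) v)
      cover v (Sv , rv) with good? G m′ h (avoid G U? r) v
      ... | yes g = inj₂ (tt , rv , g)
      ... | no ¬g = inj₁ (Sv , ¬g)

      few⇒good : ¬ (count (λ v → S? v ×-dec B? r v) ≤ κ t h)
      few⇒good few = proj₂ (S⊆ r Sr) (ℕ.+-cancelˡ-≤ (κ t h) _ _ (≤-trans
        (≮⇒≥ λ lt → none (r , Sr , lt))
        (≤-trans (count-⊎ (nbr? G S? r) (λ v → S? v ×-dec B? r v) (child? G m′ h U? r) cover)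
                 (ℕ.+-monoˡ-≤ _ few))))

  -- A vertex that is not good at height `suc h` either fails already at height `h` for the next
  -- larger threshold, where induction applies, or is stuck at height `h`, where degeneracy applies.
  -- At height 0 no vertex fails.
  colourable-unless-good : ∀ m h j → ColourableOn G (λ v → ¬ Good G (level t m j) h U? v) (colours t m h j)
  colourable-unless-good m zero    j = (λ _ → 0) , (λ _ ¬g → contradiction tt ¬g) , λ _ _ ¬g → contradiction tt ¬g
  colourable-unless-good m (suc h) j = colourableOn-⊆ G split (colourableOn-∪ G
    (λ v → ¬? (low? v))
    (colourable-unless-good m h (suc j))
    (degenerate⇒colourable G (λ v → low? v ×-dec ¬? (good? G (level t m j) (suc h) U? v))
      (stuck-degenerate ≤-refl h)))
    where
    low? = good? G (level t m (suc j)) h U?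

    split : ∀ v → ¬ Good G (level t m j) (suc h) U? v → _ ⊎ _
    split v ¬g with low? v
    ... | yes g = inj₂ (g , ¬g)
    ... | no ¬l = inj₁ ¬l

-- Growing a tree one leaf at a time

module _ (T : Graph) where
  open Graph T using (_~_; ~-sym)

  -- A construction order for a tree: each new vertex `v` has exactly one neighbour `x` among the
  -- earlier ones. The number index counts the leaves added after the root.
  data Grown : ℕ → {X : Pred (V T) 0ℓ} → Decidable X → Set₁ where
    root : ∀ r → Grown 0 (λ u → u Fin.≟ r)
    leaf : ∀ {i X} {X? : Decidable X} → Grown i X? → ∀ x v → X x → ¬ X v → x ~ v →
           (∀ y → X y → y ~ v → y ≡ x) → Grown (suc i) (λ u → X? u ⊎-dec u Fin.≟ v)

  PathIn : Pred (V T) 0ℓ → V T → V T → Set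
  PathIn X u w = ∃ λ ℓ → ∃ λ (q : Fin (suc ℓ) → V T) →
    IsPath T ℓ q × q zero ≡ u × q (fromℕ ℓ) ≡ w × (∀ i → X (q i))

  private
    opposite-inject₁ : ∀ {n} (i : Fin n) → opposite (inject₁ i) ≡ suc (opposite i)
    opposite-inject₁ zero    = refl
    opposite-inject₁ (suc i) = cong inject₁ (opposite-inject₁ i)

    opposite-fromℕ : ∀ n → opposite (fromℕ n) ≡ zero
    opposite-fromℕ zero    = refl
    opposite-fromℕ (suc n) = cong inject₁ (opposite-fromℕ n)

  reverse : ∀ {X u w} → PathIn X u w → PathIn X w u
  reverse (ℓ , q , (inj , adj) , start , end , inX) =
    ℓ , q ∘ opposite
    , ( (λ {i} {j} eq → trans (sym (Fin.opposite-involutive i))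
          (trans (cong opposite (inj eq)) (Fin.opposite-involutive j)))
      , λ i → subst (λ k → q k ~ q (inject₁ (opposite i))) (sym (opposite-inject₁ i)) (~-sym (adj (opposite i))))
    , end , trans (cong q (opposite-fromℕ ℓ)) start , inX ∘ opposite

  cons : ∀ {X u v w} → ¬ X v → v ~ u → PathIn X u w → PathIn (λ y → X y ⊎ y ≡ v) v w
  cons {X} {u} {v} ¬Xv vu (ℓ , q , (inj , adj) , start , end , inX) =
    suc ℓ , q′ , (inj′ , adj′) , refl , end , inX′
    where
    q′ : Fin (suc (suc ℓ)) → V T
    q′ zero    = v
    q′ (suc i) = q i

    inj′ : Injective _≡_ _≡_ q′
    inj′ {zero}  {zero}  eq = refl
    inj′ {zero}  {suc j} eq = contradiction (subst X (sym eq) (inX j)) ¬Xv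
    inj′ {suc i} {zero}  eq = contradiction (subst X eq (inX i)) ¬Xv
    inj′ {suc i} {suc j} eq = cong suc (inj eq)

    adj′ : ∀ (i : Fin (suc ℓ)) → q′ (inject₁ i) ~ q′ (suc i)
    adj′ zero    = subst (v ~_) (sym start) vu
    adj′ (suc i) = adj i

    inX′ : ∀ i → X (q′ i) ⊎ q′ i ≡ v
    inX′ zero    = inj₂ refl
    inX′ (suc i) = inj₁ (inX i)

  -- The invariant of the growing vertex set. Paths have to stay inside `X` so that a vertex outside
  -- can be prepended without repetition.
  Linked : Pred (V T) 0ℓ → Set
  Linked X = ∀ u w → X u → X w → PathIn X u w

  singleton-linked : ∀ r → Linked (_≡ r)
  singleton-linked r u w refl refl =
    0 , (λ _ → r) , ((λ { {zero} {zero} _ → refl }) , λ ()) , refl , refl , λ _ → refl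

  PathIn-mono : ∀ {X X′ u w} → (∀ y → X y → X′ y) → PathIn X u w → PathIn X′ u w
  PathIn-mono X⊆X′ (ℓ , q , path , start , end , inX) =
    ℓ , q , path , start , end , λ i → X⊆X′ (q i) (inX i)

  leaf-linked : ∀ {X x v} → Linked X → X x → ¬ X v → x ~ v → Linked (λ y → X y ⊎ y ≡ v)
  leaf-linked {X} {x} {v} linked Xx ¬Xv xv = λ where
      u w (inj₁ p)    (inj₁ q)    → PathIn-mono {X} {X′} (λ _ → inj₁) (linked u w p q)
      u w (inj₁ p)    (inj₂ refl) → reverse {X′} (fromLeaf u p)
      u w (inj₂ refl) (inj₁ q)    → fromLeaf w q
      u w (inj₂ refl) (inj₂ refl) → PathIn-mono {_≡ v} {X′} (λ _ → inj₂) (singleton-linked v u w refl refl)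
    where
    X′ : Pred (V T) 0ℓ
    X′ y = X y ⊎ y ≡ v

    fromLeaf : ∀ w → X w → PathIn X′ v w
    fromLeaf w Xw = cons ¬Xv (~-sym xv) (linked x w Xx Xw)

  -- A path inside `X` from `x` to `y` has at least one edge, and `v` closes it to a cycle of length
  -- at least three.
  two-attachments⇒cycle : ∀ {X x y v} → Linked X → X x → X y → ¬ X v → x ~ v → y ~ v → y ≢ x → Cycle T
  two-attachments⇒cycle {X} {x} {y} linked Xx Xy ¬Xv xv yv y≢x with linked x y Xx Xy
  ... | zero , q , _ , start , end , _ = contradiction (trans (sym end) start) y≢x
  ... | path@(suc k , _) = let _ , q , isPath , start , end , _ = cons {X} ¬Xv (~-sym xv) path in
    k , q , isPath , subst₂ _~_ (sym end) (sym start) yv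

  crossing : {X : Pred (V T) 0ℓ} → Decidable X → ∀ {u w} → Star _~_ u w → X u → ¬ X w →
             ∃ λ x → ∃ λ v → X x × ¬ X v × x ~ v
  crossing X? ε Xu ¬Xw = contradiction Xu ¬Xw
  crossing X? {u} (_◅_ {j = v} uv rest) Xu ¬Xw with X? v
  ... | yes Xv = crossing X? rest Xv ¬Xw
  ... | no ¬Xv = u , v , Xu , ¬Xv , uv

module _ (T : Tree) where
  open Tree T using (graph; vertex; connected; acyclic)
  open Graph graph using (_~_)

  -- While a vertex is missing, connectedness supplies an edge `x ~ v` leaving the current set, and
  -- acyclicity makes `x` the only neighbour of `v` there.
  grow-all : ∃ λ i → Σ (Pred (V graph) 0ℓ) λ X → Σ (Decidable X) λ X? → Grown graph i X? × (∀ v → X v)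
  grow-all = go _ (root vertex) (singleton-linked graph vertex) (vertex , refl) ≤-refl
    where
    go : ∀ k {i X} {X? : Decidable X} → Grown graph i X? → Linked graph X → ∃ X → count (λ v → ¬? (X? v)) ≤ k →
         ∃ λ i → Σ (Pred (V graph) 0ℓ) λ X → Σ (Decidable X) λ X? → Grown graph i X? × (∀ v → X v)
    go k {i} {X} {X?} grown linked (u , Xu) missing≤k with any? (λ v → ¬? (X? v))
    ... | no none = i , X , X? , grown , λ v → decidable-stable (X? v) λ ¬Xv → none (v , ¬Xv)
    go zero    {X? = X?} grown linked (u , Xu) missing≤k | yes (w , ¬Xw) =
      contradiction missing≤k (<⇒≱ (count-pos (λ v → ¬? (X? v)) w ¬Xw))
    go (suc k) {X = X} {X?} grown linked (u , Xu) missing≤k | yes (w , ¬Xw)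
      with crossing graph X? (connected u w) Xu ¬Xw
    ... | x , v , Xx , ¬Xv , xv = go k (leaf grown x v Xx ¬Xv xv unique)
        (leaf-linked graph linked Xx ¬Xv xv) (u , inj₁ Xu)
        (ℕ.≤-pred (<-≤-trans (count-mono-< (λ y → ¬? (X? y ⊎-dec y Fin.≟ v)) (λ y → ¬? (X? y))
          (λ _ ¬X′ → ¬X′ ∘ inj₁) v (λ ¬X′ → ¬X′ (inj₂ refl)) ¬Xv) missing≤k))
      where
      unique : ∀ y → X y → y ~ v → y ≡ x
      unique y Xy yv = decidable-stable (y Fin.≟ x) λ y≢x →
        acyclic (two-attachments⇒cycle graph linked Xx Xy ¬Xv xv yv y≢x)

-- Embedding a tree

-- Branching needed when `j` leaves remain to be attached. The first summand lets a tree survive one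
-- more avoided closed neighbourhood; the second exceeds the number of children spoiling the tree at
-- one of at most `n` embedded vertices.
spread : ℕ → ℕ → ℕ → ℕ
spread n t zero    = 0
spread n t (suc j) = 4 * t * suc (spread n t j) + n * κ t (suc j)

module _ (G : Graph) (t : ℕ) (1≤t : 1 ≤ t) (no-K₂ : ¬ (K 2 t ⊆ G)) (T : Graph) where
  open Graph G using (_~_; ~-sym; ~-irr)

  private
    ∣T∣ = order T
    open module T = Graph T using () renaming (_~_ to _≈_)

    instance
      t-nonZero : NonZero t
      t-nonZero = >-nonZero 1≤t

  module _ {X : Pred (V T) 0ℓ} (X? : Decidable X) (φ : V T → V G) where

    AwayFrom : V T → V G → Set
    AwayFrom x c = ∀ y → X y → y ≢ x → Far G (φ y) c

    awayFrom? : ∀ x → Decidable (AwayFrom x)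
    awayFrom? x c = all? λ y → X? y →-dec ¬? (y Fin.≟ x) →-dec far? G (φ y) c

    InducedOn : Set
    InducedOn = ∀ x y → X x → X y → x ≢ y → φ x ≢ φ y × (x ≈ y ⇔ φ x ~ φ y)

    -- Any vertex of `X` may be the one that receives the next leaf, so each image keeps a good
    -- tree, and this tree stays clear of the other images to make the embedding induced.
    Extensible : ℕ → Set
    Extensible j = ∀ x → X x → Good G (spread ∣T∣ t j) j (awayFrom? x) (φ x)

  spread-step : ∀ j → 4 * t * suc (spread ∣T∣ t j) ≤ spread ∣T∣ t (suc j)
  spread-step j = m≤m+n _ _

  spread-mono : ∀ j → spread ∣T∣ t j ≤ spread ∣T∣ t (suc j)
  spread-mono j = ≤-trans (ℕ.n≤1+n _)
    (≤-trans (ℕ.m≤n*m (suc (spread ∣T∣ t j)) (4 * t) {{ℕ.m*n≢0 4 t}}) (spread-step j))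

  -- All but ∣T∣ * κ vertices c leave the trees at the vertices chosen so far usable at height j.
  embed : ∀ {i X} {X? : Decidable X} → Grown T i X? → ∀ j r → Good G (spread ∣T∣ t (i + j)) (i + j) U? r →
          ∃ λ φ → InducedOn X? φ × Extensible X? φ j
  embed (root x) j r good = (λ _ → r)
    , (λ { u v refl refl u≢v → contradiction refl u≢v })
    , λ u u≡x → Good-mono G j U? (awayFrom? (Fin._≟ x) (λ _ → r) u) ≤-refl
        (λ c _ y y≡x y≢u → contradiction (trans y≡x (sym u≡x)) y≢u) good
  embed (leaf {i} {X} {X?} grown x v Xx ¬Xv xv unique) j r good
    -- Each leaf costs one unit of height, so the smaller tree is embedded with one more in reserve.
    with embed grown (suc j) r (subst (λ k → Good G (spread ∣T∣ t k) k U? r) (sym (ℕ.+-suc i j)) good)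
  ... | φ , induced , extensible = attach (count-< children? spoils? spoils<)
    where
    M = spread ∣T∣ t (suc j)
    M′ = spread ∣T∣ t j

    children? = child? G M j (awayFrom? X? φ x) (φ x)

    spoilsAt? : ∀ y → Decidable (λ c → X y × ¬ Good G M′ (suc j) (avoid G (awayFrom? X? φ y) c) (φ y))
    spoilsAt? y c = X? y ×-dec ¬? (good? G M′ (suc j) (avoid G (awayFrom? X? φ y) c) (φ y))

    spoils? = λ c → any? λ y → spoilsAt? y c

    spoilsAt≤ : ∀ y → count (spoilsAt? y) ≤ κ t (suc j)
    spoilsAt≤ y = ≮⇒≥ λ many → <⇒≱ many (≤-trans
      (count-mono (spoilsAt? y) (λ c → ¬? (good? G M′ (suc j) (avoid G (awayFrom? X? φ y) c) (φ y))) λ _ → proj₂)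
      (few-destroy G t 1≤t no-K₂ (spread-step j) (suc j) (awayFrom? X? φ y) (φ y)
        (extensible y (inhabited many))))
      where
      inhabited : κ t (suc j) < count (spoilsAt? y) → X y
      inhabited many = decidable-stable (X? y) λ ¬Xy →
        ℕ.n≮0 (<-≤-trans many (≤-reflexive (count-none (spoilsAt? y) λ _ → ¬Xy ∘ proj₁)))

    spoils< : count spoils? < count children?
    spoils< = begin-strict
      count spoils?                      ≤⟨ count-⋃ spoils? spoilsAt? (λ _ → id) ⟩
      sum (λ y → count (spoilsAt? y))    ≤⟨ sum-≤-* (κ t (suc j)) spoilsAt≤ ⟩
      -- The inequality that follows is strict because the other summand of `spread` is positive.
      ∣T∣ * κ t (suc j)
        <⟨ ℕ.m<n+m _ (ℕ.*-mono-≤ {1} {4 * t} (≤-trans 1≤t (m≤m+n t _)) (s≤s (z≤n {M′}))) ⟩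
      M                                  ≤⟨ extensible x Xx ⟩
      count children?                    ∎
      where open ℕ.≤-Reasoning

    attach : (∃ λ c → (AwayFrom X? φ x c × φ x ~ c × Good G M j (avoid G (awayFrom? X? φ x) (φ x)) c) ×
                      ¬ (∃ λ y → X y × ¬ Good G M′ (suc j) (avoid G (awayFrom? X? φ y) c) (φ y))) →
             ∃ λ φ → InducedOn (λ u → X? u ⊎-dec u Fin.≟ v) φ × Extensible (λ u → X? u ⊎-dec u Fin.≟ v) φ j
    attach (c , (away , xc , good-c) , unspoilt) = φ′ , induced′ , extensible′
      where
      X′? : Decidable (λ u → X u ⊎ u ≡ v)
      X′? u = X? u ⊎-dec u Fin.≟ v

      φ′ : V T → V G
      φ′ = updateAt φ v (const c)

      φ′-new : φ′ v ≡ c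
      φ′-new = updateAt-updates v φ

      φ′-old : ∀ {y} → X y → φ′ y ≡ φ y
      φ′-old Xy = updateAt-minimal _ v φ λ { refl → ¬Xv Xy }

      new-old : ∀ y → X y → φ y ≢ c × (y ≈ v ⇔ φ y ~ c)
      new-old y Xy with y Fin.≟ x
      ... | yes refl = (λ eq → ~-irr eq xc) , mk⇔ (const xc) (const xv)
      ... | no y≢x   = proj₂ (away y Xy y≢x)
        , mk⇔ (λ yv → contradiction (unique y Xy yv) y≢x) (λ yc → contradiction yc (proj₁ (away y Xy y≢x)))

      induced′ : InducedOn X′? φ′
      induced′ y z (inj₁ Xy) (inj₁ Xz) y≢z rewrite φ′-old Xy | φ′-old Xz = induced y z Xy Xz y≢z
      induced′ y z (inj₁ Xy) (inj₂ refl) y≢z rewrite φ′-old Xy | φ′-new = new-old y Xy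
      induced′ y z (inj₂ refl) (inj₁ Xz) y≢z rewrite φ′-old Xz | φ′-new = let ne , adj = new-old z Xz in
        ne ∘ sym , mk⇔ (~-sym ∘ Equivalence.to adj ∘ T.~-sym) (T.~-sym ∘ Equivalence.from adj ∘ ~-sym)
      induced′ y z (inj₂ refl) (inj₂ refl) y≢z = contradiction refl y≢z

      extensible′ : Extensible X′? φ′ j
      -- `c` does not spoil the tree at `φ y`: once the closed neighbourhood of `c` is avoided,
      -- branching `M′` and height `suc j` remain, and the height is then cut to `j`.
      extensible′ y (inj₁ Xy) rewrite φ′-old Xy =
        Good-mono G j (avoid G (awayFrom? X? φ y) c) (awayFrom? X′? φ′ y) ≤-refl
          (λ { d (away-d , far-d) z (inj₁ Xz) z≢y → subst (λ w → Far G w d) (sym (φ′-old Xz)) (away-d z Xz z≢y)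
             ; d (away-d , far-d) z (inj₂ refl) _ → subst (λ w → Far G w d) (sym φ′-new) far-d })
          (Good-pred G j (avoid G (awayFrom? X? φ y) c)
            (decidable-stable (good? G M′ (suc j) (avoid G (awayFrom? X? φ y) c) (φ y))
              λ ¬g → unspoilt (y , Xy , ¬g)))
      -- The tree at `c` is the subtree of the one at `φ x`, which avoids the closed neighbourhood
      -- of `φ x` by the definition of a child.
      extensible′ y (inj₂ refl) rewrite φ′-new =
        Good-mono G j (avoid G (awayFrom? X? φ x) (φ x)) (awayFrom? X′? φ′ v) (spread-mono j) shrink good-c
        where
        shrink : ∀ d → AwayFrom X? φ x d × Far G (φ x) d → AwayFrom X′? φ′ v d
        shrink d (away-d , far-d) z (inj₂ z≡v) z≢v = contradiction z≡v z≢v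
        shrink d (away-d , far-d) z (inj₁ Xz) _ rewrite φ′-old Xz with z Fin.≟ x
        ... | yes refl = far-d
        ... | no z≢x   = away-d z Xz z≢x

  good⇒induced : ∀ {i X} {X? : Decidable X} → Grown T i X? → (∀ v → X v) →
                 ∀ r → Good G (spread ∣T∣ t i) i U? r → T ⊆ᵢ G
  good⇒induced {i} grown full r good
    with embed grown 0 r (subst (λ k → Good G (spread ∣T∣ t k) k U? r) (sym (ℕ.+-identityʳ i)) good)
  ... | φ , induced , _ = φ , inj , iff
    where
    inj : Injective _≡_ _≡_ φ
    inj {x} {y} eq = decidable-stable (x Fin.≟ y) λ x≢y → proj₁ (induced x y (full x) (full y) x≢y) eq

    iff : ∀ x y → x ≈ y ⇔ φ x ~ φ y
    iff x y with x Fin.≟ y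
    ... | yes refl = mk⇔ (λ xx → contradiction xx (T.~-irr refl)) (λ xx → contradiction xx (~-irr refl))
    ... | no x≢y   = proj₂ (induced x y (full x) (full y) x≢y)

-- Polynomial bounds

-- One monomial suffices as a bound because only `t ≥ 1` matters, where powers grow with the
-- exponent.
record PolyBounded (g : ℕ → ℕ) : Set where
  constructor polyBounded
  field
    coeff exponent : ℕ
    bound          : ∀ t → 1 ≤ t → g t ≤ coeff * t ^ exponent

module _ where
  open PolyBounded
  open ℕ.≤-Reasoning

  const-poly : ∀ c → PolyBounded (λ _ → c)
  const-poly c = polyBounded c 0 λ t _ → ≤-reflexive (sym (ℕ.*-identityʳ c))

  id-poly : PolyBounded (λ t → t)
  id-poly = polyBounded 1 1 λ t _ → ≤-reflexive (sym (trans (ℕ.*-identityˡ _) (ℕ.^-identityʳ t)))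

  +-poly : ∀ {f g} → PolyBounded f → PolyBounded g → PolyBounded (λ t → f t + g t)
  +-poly {f} {g} p q = polyBounded (coeff p + coeff q) (exponent p + exponent q) λ where
    t@(suc _) 1≤t → begin
      f t + g t
        ≤⟨ +-mono-≤ (≤-trans (bound p t 1≤t) (*-monoʳ-≤ (coeff p) (ℕ.^-monoʳ-≤ t (m≤m+n (exponent p) (exponent q)))))
                    (≤-trans (bound q t 1≤t) (*-monoʳ-≤ (coeff q) (ℕ.^-monoʳ-≤ t (m≤n+m (exponent q) (exponent p))))) ⟩
      coeff p * t ^ (exponent p + exponent q) + coeff q * t ^ (exponent p + exponent q)
        ≡⟨ ℕ.*-distribʳ-+ (t ^ (exponent p + exponent q)) (coeff p) (coeff q) ⟨
      (coeff p + coeff q) * t ^ (exponent p + exponent q) ∎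

  *-poly : ∀ {f g} → PolyBounded f → PolyBounded g → PolyBounded (λ t → f t * g t)
  *-poly {f} {g} p q = polyBounded (coeff p * coeff q) (exponent p + exponent q) λ t 1≤t → begin
    f t * g t
      ≤⟨ *-mono-≤ (bound p t 1≤t) (bound q t 1≤t) ⟩
    coeff p * t ^ exponent p * (coeff q * t ^ exponent q)
      ≡⟨ solve 4 (λ a x b y → a :* x :* (b :* y) := a :* b :* (x :* y)) refl
           (coeff p) (t ^ exponent p) (coeff q) (t ^ exponent q) ⟩
    coeff p * coeff q * (t ^ exponent p * t ^ exponent q)
      ≡⟨ cong (coeff p * coeff q *_) (ℕ.^-distribˡ-+-* t (exponent p) (exponent q)) ⟨
    coeff p * coeff q * t ^ (exponent p + exponent q) ∎
    where open +-*-Solver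

  ^-poly : ∀ {f} → PolyBounded f → ∀ k → PolyBounded (λ t → f t ^ k)
  ^-poly p zero    = const-poly 1
  ^-poly p (suc k) = *-poly p (^-poly p k)

suc-poly : ∀ {f} → PolyBounded f → PolyBounded (λ t → suc (f t))
suc-poly = +-poly (const-poly 1)

4t*suc-poly : ∀ {f} → PolyBounded f → PolyBounded (λ t → 4 * t * suc (f t))
4t*suc-poly p = *-poly (*-poly (const-poly 4) id-poly) (suc-poly p)

κ-poly : ∀ h → PolyBounded (λ t → κ t h)
κ-poly zero    = const-poly 0
κ-poly (suc h) = +-poly id-poly (4t*suc-poly (κ-poly h))

spread-poly : ∀ n j → PolyBounded (λ t → spread n t j)
spread-poly n zero    = const-poly 0
spread-poly n (suc j) = +-poly (4t*suc-poly (spread-poly n j)) (*-poly (const-poly n) (κ-poly (suc j)))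

level-poly : ∀ {m} → PolyBounded m → ∀ j → PolyBounded (λ t → level t (m t) j)
level-poly m-poly zero    = m-poly
level-poly m-poly (suc j) = 4t*suc-poly (level-poly m-poly j)

colours-poly : ∀ {m} → PolyBounded m → ∀ h j → PolyBounded (λ t → colours t (m t) h j)
colours-poly m-poly zero    j = const-poly 0
colours-poly m-poly (suc h) j =
  +-poly (colours-poly m-poly h (suc j)) (+-poly (κ-poly h) (level-poly m-poly j))

-- For a fixed tree the exponent in `β T` is a constant, and the base is a constant multiple of `t`.
β-poly : ∀ T → PolyBounded (β T)
β-poly T = +-poly (^-poly (*-poly (const-poly (listSum (map (λ i → s ^ (i + 1)) (upTo (p + 1))))) id-poly)
                         ((p + 3) ! * listSum (map (λ i → s ^ i) (upTo (p + 1)))))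
                  (const-poly 1)
  where
  s = maxDegree T
  p = minHeight T

eval-monomial : ∀ c e → ∃ λ f → ∀ t → eval f (+ t) ≡ + (c * t ^ e)
eval-monomial c zero = + c ∷ [] , λ t → begin
  + c ℤ.+ + t ℤ.* 0ℤ  ≡⟨ cong (ℤ._+_ (+ c)) (ℤ.*-zeroʳ (+ t)) ⟩
  + c ℤ.+ 0ℤ          ≡⟨ ℤ.+-identityʳ (+ c) ⟩
  + c                 ≡⟨ cong +_ (ℕ.*-identityʳ c) ⟨
  + (c * 1)           ∎
  where open ≡-Reasoning
eval-monomial c (suc e) with eval-monomial c e
... | f , eval-f = 0ℤ ∷ f , λ t → begin
  0ℤ ℤ.+ + t ℤ.* eval f (+ t)  ≡⟨ ℤ.+-identityˡ _ ⟩
  + t ℤ.* eval f (+ t)         ≡⟨ cong (+ t ℤ.*_) (eval-f t) ⟩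
  + t ℤ.* + (c * t ^ e)        ≡⟨ ℤ.pos-* t (c * t ^ e) ⟨
  + (t * (c * t ^ e))          ≡⟨ cong +_ (solve 3 (λ t c x → t :* (c :* x) := c :* (t :* x)) refl t c (t ^ e)) ⟩
  + (c * (t * t ^ e))          ∎
  where
  open ≡-Reasoning
  open +-*-Solver

polynomial : ∀ {g} → PolyBounded g → ∃ λ f → ∀ t → 1 ≤ t → + g t ℤ.≤ eval f (+ t)
polynomial (polyBounded c e bound) = let f , eval-f = eval-monomial c e in
  f , λ t 1≤t → ℤ.≤-trans (ℤ.+≤+ (bound t 1≤t)) (ℤ.≤-reflexive (sym (eval-f t)))

-- Excluding a biclique

-- A good vertex at height `i` with branching `spread` would root an induced copy of `T`. Hence no
-- vertex is good, and `colourable-unless-good` colours the whole graph. `C` and `e` depend on `T`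
-- alone.
biclique-free-bound : ∀ T → ∃ λ C → ∃ λ e → ∀ t → 1 ≤ t → ∀ G → G IsFreeOf Tree.graph T → ¬ (K 2 t ⊆ G) →
                      Colourable G (C * t ^ e)
biclique-free-bound T with grow-all T
... | i , X , X? , grown , full = coeff p , exponent p , colouring
  where
  open PolyBounded
  ∣T∣ = order (Tree.graph T)

  p : PolyBounded (λ t → colours t (spread ∣T∣ t i) i 0)
  p = colours-poly (spread-poly ∣T∣ i) i 0

  colouring : ∀ t → 1 ≤ t → ∀ G → G IsFreeOf Tree.graph T → ¬ (K 2 t ⊆ G) →
              Colourable G (coeff p * t ^ exponent p)
  colouring t 1≤t G free no-K₂ with colourable-unless-good G t 1≤t no-K₂ (spread ∣T∣ t i) i 0
  ... | f , f< , proper = (λ v → fromℕ< (f<′ v)) , λ u v uv eq →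
      proper u v (bad u) (bad v) uv (Fin.fromℕ<-injective _ _ (f<′ u) (f<′ v) eq)
    where
    bad : ∀ v → ¬ Good G (spread ∣T∣ t i) i U? v
    bad v = free ∘ good⇒induced G t 1≤t no-K₂ (Tree.graph T) grown full v

    f<′ : ∀ v → f v < coeff p * t ^ exponent p
    f<′ v = <-≤-trans (f< v (bad v)) (bound p t 1≤t)

-- Multiplying the parts

induced-free : ∀ {G T N} {φ : Fin N → V G} (inj : Injective _≡_ _≡_ φ) →
               G IsFreeOf T → induced G φ inj IsFreeOf T
induced-free {φ = φ} inj free (ψ , ψ-inj , iff) = free (φ ∘ ψ , ψ-inj ∘ inj , iff)

pigeonhole : ∀ {N c} b (f : Fin N → Fin c) → c * b < N → ∃ λ x → b ≤ count (λ i → f i Fin.≟ x)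
pigeonhole {N} {c} b f cb<N with any? (λ x → b ℕ.≤? count (λ i → f i Fin.≟ x))
... | yes found = found
... | no none = contradiction (begin
  N                           ≤⟨ count-all (λ i → any? λ x → f i Fin.≟ x) (λ i → f i , refl) ⟩
  count (λ i → any? λ x → f i Fin.≟ x)
                              ≤⟨ count-⋃ _ (λ x i → f i Fin.≟ x) (λ _ → id) ⟩
  sum (λ x → count (λ i → f i Fin.≟ x))
                              ≤⟨ sum-≤-* b (λ x → <⇒≤ (≰⇒> λ b≤ → none (x , b≤))) ⟩
  c * b                       ∎) (<⇒≱ cb<N)
  where open ℕ.≤-Reasoning

independent : ∀ {G N c} b (φ : Fin N → V G) (inj : Injective _≡_ _≡_ φ) →
              Colourable (induced G φ inj) c → c * b < N →
              ∃ λ (f : Fin b → Fin N) → Injective _≡_ _≡_ f × (∀ i j → ¬ Graph._~_ G (φ (f i)) (φ (f j)))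
independent b φ inj (f , proper) cb<N with pigeonhole b f cb<N
... | x , b≤ with pick b (λ i → f i Fin.≟ x) b≤
...   | g , g-inj , g-x = g , g-inj , λ i j adj → proper (g i) (g j) adj (trans (g-x i) (sym (g-x j)))

-- Part `i` is replaced by the two sides of the biclique found inside it, one of them placed in
-- front as the new part; all other parts are cut down to `N′` vertices.
refine : ∀ {G k N N′} → ((P , inj , _) : ∃ (IsMultipartite G {k} {N})) → N′ ≤ N →
         ∀ i → K 2 N′ ⊆ induced G (P i) (inj i) → K (suc k) N′ ⊆ G
refine {G} {k} {N} {N′} (P , inj , adj) N′≤N i copy with parts (induced G (P i) (inj i)) copy
... | Q , Q-inj , Q-adj = copyOf G R , copyOf-isCopy G (R-inj , R-adj)
  where
  open Graph G using (_~_; ~-sym)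

  R : Fin (suc k) → Fin N′ → V G
  R zero     j = P i (Q zero j)
  R (suc i′) j with i′ Fin.≟ i
  ... | yes _ = P i (Q (suc zero) j)
  ... | no _  = P i′ (inject≤ j N′≤N)

  R-inj : ∀ i′ → Injective _≡_ _≡_ (R i′)
  R-inj zero     eq = Q-inj zero (inj i eq)
  R-inj (suc i′) eq with i′ Fin.≟ i
  ... | yes _ = Q-inj (suc zero) (inj i eq)
  ... | no _  = Fin.inject≤-injective N′≤N N′≤N _ _ (inj i′ eq)

  R-new : ∀ i′ j j′ → R zero j ~ R (suc i′) j′
  R-new i′ j j′ with i′ Fin.≟ i
  ... | yes _    = Q-adj zero (suc zero) j j′ λ ()
  ... | no i′≢i  = adj _ _ _ _ (i′≢i ∘ sym)

  R-adj : ∀ a a′ j j′ → a ≢ a′ → R a j ~ R a′ j′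
  R-adj zero     zero      j j′ a≢a′ = contradiction refl a≢a′
  R-adj zero     (suc i′)  j j′ _    = R-new i′ j j′
  R-adj (suc i′) zero      j j′ _    = ~-sym (R-new i′ j′ j)
  R-adj (suc a)  (suc a′)  j j′ a≢a′ with a Fin.≟ i | a′ Fin.≟ i
  ... | yes refl | yes refl = contradiction refl a≢a′
  ... | yes refl | no a′≢i  = adj _ _ _ _ (a′≢i ∘ sym)
  ... | no a≢i   | yes refl = adj _ _ _ _ a≢i
  ... | no _     | no _     = adj _ _ _ _ (a≢a′ ∘ cong suc)

module _ (C e : ℕ) (b : ℕ → ℕ) where

  -- Part size that allows `j` more splittings. The first summand lets the unsplit parts shrink to
  -- `size t j`; the second forces a colour class of size `b t` in a part coloured with
  -- `C * size t j ^ e` colours.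
  size : ℕ → ℕ → ℕ
  size t zero    = t
  size t (suc j) = size t j + suc (C * size t j ^ e * b t)

  size-poly : PolyBounded b → ∀ j → PolyBounded (λ t → size t j)
  size-poly b-poly zero    = id-poly
  size-poly b-poly (suc j) = +-poly (size-poly b-poly j)
    (suc-poly (*-poly (*-poly (const-poly C) (^-poly (size-poly b-poly j) e)) b-poly))

  t≤size : ∀ t j → t ≤ size t j
  t≤size t zero    = ≤-refl
  t≤size t (suc j) = ≤-trans (t≤size t j) (m≤m+n _ _)

module _ (T : Graph) (C e : ℕ) (b : ℕ → ℕ)
         (colouring : ∀ t → 1 ≤ t → ∀ G → G IsFreeOf T → ¬ (K 2 t ⊆ G) → Colourable G (C * t ^ e)) where

  -- The condition defining 𝓕₂, with b in place of β T.
  Rich : ℕ → Graph → Set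
  Rich t G = ∀ φ (copy : IsCopy (K 2 (b t)) G φ) → ∃ λ i → K 2 t ⊆ inducedOnPart G 2 (b t) φ copy i

  module _ (t : ℕ) (1≤t : 1 ≤ t) (G : Graph) (free : G IsFreeOf T) (rich : Rich t G) where
    open Graph G using (_~_)

    -- Richness puts a copy of `K 2 t` inside one part, and this copy has an edge because `1 ≤ t`.
    ¬both-independent : (P : Fin 2 → Fin (b t) → V G) → IsMultipartite G P → ¬ (∀ i j j′ → ¬ P i j ~ P i j′)
    ¬both-independent P multi indep with rich (copyOf G P) (copyOf-isCopy G multi)
    ... | i , copy with parts (inducedOnPart G 2 (b t) (copyOf G P) (copyOf-isCopy G multi) i) copy
    ...   | Q , _ , Q-adj = indep i (Q zero j₀) (Q (suc zero) j₀)
      (subst₂ _~_ (copyOf-combine G P i _) (copyOf-combine G P i _) (Q-adj zero (suc zero) j₀ j₀ λ ()))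
      where
      j₀ : Fin t
      j₀ = fromℕ< 1≤t

    -- Only the first two parts are examined. If neither contains the required biclique, both have
    -- few colours, and their large colour classes span a `K 2 (b t)` with independent sides.
    one-more-part : ∀ k j → K (2 + k) (size C e b t (suc j)) ⊆ G → K (3 + k) (size C e b t j) ⊆ G
    one-more-part k j copy with parts G copy
    ... | multi@(P , inj , adj)
      with K 2 (size C e b t j) ⊆? induced G (P zero) (inj zero)
         | K 2 (size C e b t j) ⊆? induced G (P (suc zero)) (inj (suc zero))
    ...   | yes K⊆ | _      = refine {G} {N′ = size C e b t j} multi (m≤m+n _ _) zero K⊆
    ...   | no _   | yes K⊆ = refine {G} {N′ = size C e b t j} multi (m≤m+n _ _) (suc zero) K⊆
    ...   | no K⊈₀ | no K⊈₁ = contradiction (λ i j j′ → proj₂ (proj₂ (indep i)) j j′)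
      (¬both-independent (λ i → P (two i) ∘ proj₁ (indep i))
        ( (λ i → proj₁ (proj₂ (indep i)) ∘ inj (two i))
        , λ i i′ _ _ i≢i′ → adj _ _ _ _ (i≢i′ ∘ Fin.inject≤-injective 2≤2+k 2≤2+k i i′)))
      where
      2≤2+k : 2 ≤ 2 + k
      2≤2+k = s≤s (s≤s z≤n)

      two : Fin 2 → Fin (2 + k)
      two i = inject≤ i 2≤2+k

      K⊈ : ∀ i → ¬ (K 2 (size C e b t j) ⊆ induced G (P (two i)) (inj (two i)))
      K⊈ zero       = K⊈₀
      K⊈ (suc zero) = K⊈₁

      indep : ∀ i → ∃ λ (f : Fin (b t) → Fin (size C e b t (suc j))) → Injective _≡_ _≡_ f ×
                    (∀ x y → ¬ P (two i) (f x) ~ P (two i) (f y))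
      indep i = independent {G} (b t) (P (two i)) (inj (two i))
        (colouring (size C e b t j) (≤-trans 1≤t (t≤size C e b t j)) (induced G (P (two i)) (inj (two i)))
          (induced-free {G} {T} (inj (two i)) free) (K⊈ i))
        (m≤n+m _ (size C e b t j))

    many-parts : ∀ k j → K (2 + k) (size C e b t j) ⊆ G → K (2 + (j + k)) t ⊆ G
    many-parts k zero    copy = copy
    many-parts k (suc j) copy = subst (λ i → K (2 + i) t ⊆ G) (ℕ.+-suc j k)
      (many-parts (suc k) j (one-more-part k j copy))

  no-biclique : ∀ d t → 1 ≤ t → (G : Graph) → τ 2 G < t ⊎ Rich t G → G IsFreeOf T → ¬ (K d t ⊆ G) →
                ¬ (K 2 (size C e b t d) ⊆ G)
  no-biclique d t 1≤t G (inj₁ τ<t) free no-K copy =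
    -- Since `size` is at least `t`, the copy contains `K 2 t`, which forces `τ 2 G` to be at least
    -- `t`.
    <⇒≱ τ<t (proj₂ (proj₂ (τ-greatest 2 G)) t (K-mono G {2} {2} id id (t≤size C e b t d) copy))
  no-biclique d t 1≤t G (inj₂ rich) free no-K copy =
    -- Starting from two parts, `d` rounds of splitting yield `2 + d` parts of size `t`; the first
    -- two are dropped.
    no-K (K-mono G {2 + (d + 0)} {d} (λ i → suc (suc (inject≤ i (m≤m+n d 0))))
      (Fin.inject≤-injective _ _ _ _ ∘ Fin.suc-injective ∘ Fin.suc-injective) ≤-refl
      (many-parts t 1≤t G free rich 0 d copy))

  χ-≤ : ∀ d t → 1 ≤ t → (G : Graph) → τ 2 G < t ⊎ Rich t G → G IsFreeOf T → ¬ (K d t ⊆ G) →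
        χ G ≤ C * size C e b t d ^ e
  χ-≤ d t 1≤t G class free no-K = proj₂ (proj₂ (χ-least G)) (C * size C e b t d ^ e)
    (colouring (size C e b t d) (≤-trans 1≤t (t≤size C e b t d)) G free (no-biclique d t 1≤t G class free no-K))

theorem11 : ∀ (d : ℕ) → 1 ≤ d → (T : Tree) →
    ∃ λ (f : Polynomial) → ∀ (t : ℕ) → 1 ≤ t → (G : Graph) →
    𝓕 T t G → G IsFreeOf (Tree.graph T) → ¬ (K d t ⊆ G) →
    (+ χ G) ℤ.≤ eval f (+ t)
theorem11 d _ T = let C , e , colouring = biclique-free-bound T
                      f , bound = polynomial (χ-bound-poly C e) in
  f , λ t 1≤t G G∈𝓕 free no-K → ℤ.≤-trans
    (ℤ.+≤+ (χ-≤ (Tree.graph T) C e (β T) colouring d t 1≤t G (Sum.map₂ proj₂ G∈𝓕) free no-K))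
    (bound t 1≤t)
  where
  -- With `d` and `T` fixed, `size` is iterated a constant number of times, so the bound remains
  -- polynomial in `t`.
  χ-bound-poly : ∀ C e → PolyBounded (λ t → C * size C e (β T) t d ^ e)
  χ-bound-poly C e = *-poly (const-poly C) (^-poly (size-poly C e (β T) (β-poly T) d) e)
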